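{- For every BPPS instance, every feasible solution $(x,y,z)$ of the integer linear program $\mathrm{ILP}_{\mathrm N}$ satisfies the Minimum Bins Inequality $$\sum_{b\in\mathcal B}z_b\ \ge\ \left\lceil\frac{\sum_{i\in\mathcal I}w_i+\sum_{c\in\mathcal C}\gamma_c\,s_c}{d}\right\rceil .$$
   Context: Bin Packing Problem with Setups (BPPS). An instance consists of: a bin capacity $d\in\mathbb Z_{\ge1}$; items $\mathcal I=\{1,\dots,n\}$ with weights $w_i\in\mathbb Z_{\ge1}$; classes $\mathcal C=\{1,\dots,m\}$ and a partition $\{\mathcal I_1,\dots,\mathcal I_m\}$ of $\mathcal I$ into (nonempty) classes; for each class $c$ a setup weight $s_c\in\mathbb Z_{\ge0}$ and a setup cost $f_c\in\mathbb Z_{\ge0}$; a bin cost $r\in\mathbb Z_{\ge1}$. It is assumed that $w_i+s_c\le d$ for all $c\in\mathcal C$, $i\in\mathcal I_c$, and that the items cannot all be packed in a single bin, i.e. $\sum_{i\in\mathcal I}w_i+\sum_{c\in\mathcal C}s_c>d$. For $S\subseteq\mathcal I$ let $\mathcal C(S)=\{c\in\mathcal C: S\cap\mathcal I_c\neq\emptyset\}$. A packing pattern is a subset $S\subseteq\mathcal I$ with $\sum_{i\in S}w_i+\sum_{c\in\mathcal C(S)}s_c\le d$. A feasible BPPS solution is a partition $\mathcal S$ of $\mathcal I$ into (nonempty) packing patterns (used bins); its cost is $r|\mathcal S|+\sum_{S\in\mathcal S}\sum_{c\in\mathcal C(S)}f_c$, to be minimized. For $c\in\mathcal C$ let $\gamma_c=\left\lceil\frac{\sum_{i\in\mathcal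 I_c}w_i}{d-s_c}\right\rceil$. Let $k\in\mathbb Z_{\ge1}$ be an upper bound on the number of bins used in any optimal BPPS solution and $\mathcal B=\{1,\dots,k\}$. The integer linear program $\mathrm{ILP}_{\mathrm N}$ is: minimize $\sum_{b\in\mathcal B}\big(r z_b+\sum_{c\in\mathcal C}f_c y_{cb}\big)$ subject to - $\sum_{b\in\mathcal B}x_{ib}=1$ for all $i\in\mathcal I$; - $\sum_{i\in\mathcal I}w_ix_{ib}+\sum_{c\in\mathcal C}s_cy_{cb}\le d\,z_b$ for all $b\in\mathcal B$; - $x_{ib}\le y_{cb}$ for all $c\in\mathcal C$, $i\in\mathcal I_c$, $b\in\mathcal B$; - $x_{ib},y_{cb},z_b\in\{0,1\}$ for all $i\in\mathcal I,c\in\mathcal C,b\in\mathcal B$. -}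

module Defs where

open import Data.Bool.Base using (if_then_else_)
open import Data.Fin.Base using (Fin)
open import Data.Fin.Subset using (Subset; _∈_; _∩_; Nonempty)
open import Data.Fin.Subset.Properties using (nonempty?)
open import Data.Integer.Base as ℤ using (+_; ∣_∣)
import Data.Integer.Properties as ℤ
open import Data.Nat.Base
  using (ℕ; zero; suc; z≤n; NonZero; >-nonZero; _+_; _*_; _∸_; _≤_; _<_; _%_)
import Data.Nat.Base as ℕ using (_/_)
open import Data.Nat.Properties
  using (+-*-semiring; ≤-trans; +-monoˡ-≤; m<n⇒0<n∸m)
open import Data.Product using (∃!; _,_)
open import Data.Rational.Unnormalised.Base as ℚᵘ using (ceiling)
open import Data.Sum.Base using (_⊎_)
open import Data.Vec.Base using (lookup; tabulate)
open import Relation.Binary.PropositionalEquality using (_≡_)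
open import Relation.Nullary.Decidable.Core using (does)

open import Algebra.Properties.Semiring.Sum +-*-semiring public
  using (sum; sum-syntax)

sum∈ : ∀ {n} → Subset n → (Fin n → ℕ) → ℕ
sum∈ {n} S f = ∑[ i < n ] (if lookup S i then f i else 0)

infixl 10 sum∈
syntax sum∈ S (λ i → x) = ∑[ i ∈ S ] x

-- Taking the absolute value only moves the ceiling from ℤ to ℕ: see +⌈/⌉≡ceiling.
⌈_/_⌉ : (a b : ℕ) .{{_ : NonZero b}} → ℕ
⌈ a / b ⌉ = ∣ ceiling (+ a ℚᵘ./ b) ∣

+⌈/⌉≡ceiling : ∀ a b .{{_ : NonZero b}} → + ⌈ a / b ⌉ ≡ ceiling (+ a ℚᵘ./ b)
+⌈/⌉≡ceiling a (suc b) = ℤ.0≤i⇒+∣i∣≡i (nonneg a)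
  where
  nonneg : ∀ a → + 0 ℤ.≤ ceiling (+ a ℚᵘ./ suc b)
  nonneg zero = ℤ.≤-refl
  nonneg (suc a) rewrite ℤ.*-identityˡ (ℤ.-[1+ a ] ℤ./ℕ suc b)
    with suc a % suc b
  ... | suc _ = ℤ.+≤+ z≤n
  ... | zero rewrite ℤ.neg-involutive (+ (suc a ℕ./ suc b)) = ℤ.+≤+ z≤n

-- Blocks are nonempty and disjoint, hence pairwise distinct, so p is the
-- cardinality of the partition.
record Partition (n p : ℕ) : Set where
  field
    block      : Fin p → Subset n
    nonempty   : ∀ b → Nonempty (block b)
    exactlyOne : ∀ i → ∃! _≡_ (λ b → i ∈ block b)

record BPPS : Set where
  field
    n m     : ℕ
    d r     : ℕ
    w       : Fin n → ℕ
    s f     : Fin m → ℕ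
    classes : Partition n m

  open Partition classes public using () renaming (block to 𝓘)

  field
    d≥1        : 1 ≤ d
    r≥1        : 1 ≤ r
    w≥1        : ∀ i → 1 ≤ w i
    w+s≤d      : ∀ c i → i ∈ 𝓘 c → w i + s c ≤ d
    not-in-one : d < ∑[ i < n ] w i + ∑[ c < m ] s c

  s<d : ∀ c → s c < d
  s<d c with Partition.nonempty classes c
  ... | i , i∈𝓘c = ≤-trans (+-monoˡ-≤ (s c) (w≥1 i)) (w+s≤d c i i∈𝓘c)

  d≢0 : NonZero d
  d≢0 = >-nonZero d≥1

  d∸s≢0 : ∀ c → NonZero (d ∸ s c)
  d∸s≢0 c = >-nonZero (m<n⇒0<n∸m (s<d c))

  𝓒 : Subset n → Subset m
  𝓒 S = tabulate (λ c → does (nonempty? (S ∩ 𝓘 c)))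

  IsPattern : Subset n → Set
  IsPattern S = ∑[ i ∈ S ] w i + ∑[ c ∈ 𝓒 S ] s c ≤ d

  record Solution (p : ℕ) : Set where
    field
      bins     : Partition n p
      patterns : ∀ b → IsPattern (Partition.block bins b)

    cost : ℕ
    cost = r * p + ∑[ b < p ] (∑[ c ∈ 𝓒 (Partition.block bins b) ] f c)

  open Solution public using (cost)

  IsOptimal : ∀ {p} → Solution p → Set
  IsOptimal S = ∀ {q} (T : Solution q) → cost S ≤ cost T

  BoundsOptimalBins : ℕ → Set
  BoundsOptimalBins k = ∀ {p} (S : Solution p) → IsOptimal S → p ≤ k

  γ : Fin m → ℕ
  γ c = ⌈ ∑[ i ∈ 𝓘 c ] w i / d ∸ s c ⌉ {{d∸s≢0 c}}

Binary : ℕ → Set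
Binary v = v ≡ 0 ⊎ v ≡ 1

module ILP-N (I : BPPS) (k : ℕ) where
  open BPPS I

  record Feasible (x : Fin n → Fin k → ℕ) (y : Fin m → Fin k → ℕ) (z : Fin k → ℕ) : Set where
    field
      assignment : ∀ i → ∑[ b < k ] x i b ≡ 1
      capacity   : ∀ b → ∑[ i < n ] (w i * x i b) + ∑[ c < m ] (s c * y c b) ≤ d * z b
      setup      : ∀ c i → i ∈ 𝓘 c → ∀ b → x i b ≤ y c b
      x-binary   : ∀ i b → Binary (x i b)
      y-binary   : ∀ c b → Binary (y c b)
      z-binary   : ∀ b → Binary (z b)

  objective : (y : Fin m → Fin k → ℕ) (z : Fin k → ℕ) → ℕ
  objective y z = ∑[ b < k ] (r * z b + ∑[ c < m ] (f c * y c b))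

{-# OPTIONS --safe #-}
-- Within one bin, class c occupies at most d ∸ s c units, and none unless its setup is
-- paid; summing over the bins shows that at least γ c bins pay the setup of c.
-- Adding up all capacity constraints then gives ∑ w + ∑ γ s ≤ d ∑ z.
module Submission where

open import Defs
open import Data.Bool.Base using (true; false; if_then_else_)
open import Data.Fin.Base using (Fin; zero; suc)
open import Data.Fin.Subset using (Subset; _∈_)
open import Data.Integer.Base as ℤ using (+_)
open import Data.Integer.DivMod using (div-pos-is-/ℕ; n<s[n/ℕd]*d)
import Data.Integer.Properties as ℤ
open import Data.Nat.Base using (ℕ; zero; suc; NonZero; z≤n; _≤_; _≥_; _+_; _*_; _∸_)
open import Data.Nat.Properties
open import Data.Sum.Base using (inj₁; inj₂)
open import Data.Vec.Base using (lookup)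
open import Data.Vec.Properties using (lookup⇒[]=)
open import Relation.Binary.PropositionalEquality
  using (_≡_; refl; sym; trans; cong; cong₂; subst)

open import Algebra.Properties.Semiring.Sum +-*-semiring
  using (sum-cong-≗; sum-replicate-zero; ∑-distrib-+; ∑-comm; *-distribˡ-sum)

-- If the quotient were below `i`, its successor would be at most `i`; but the successor times `d`
-- already exceeds `n`, while `i * d` does not.
i*d≤n⇒i≤n/ℕd : ∀ i n d .{{_ : NonZero d}} → i ℤ.* + d ℤ.≤ n → i ℤ.≤ n ℤ./ℕ d
i*d≤n⇒i≤n/ℕd i n d id≤n = ℤ.≮⇒≥ λ n/d<i → ℤ.<-irrefl refl (begin-strict
  n                         <⟨ n<s[n/ℕd]*d n d ⟩
  ℤ.suc (n ℤ./ℕ d) ℤ.* + d  ≤⟨ ℤ.*-monoʳ-≤-nonNeg (+ d) (ℤ.i<j⇒suc[i]≤j n/d<i) ⟩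
  i ℤ.* + d                 ≤⟨ id≤n ⟩
  n                         ∎)
  where open ℤ.≤-Reasoning

-- The ceiling is minus the floor of the negated fraction, so a lower bound `- t` on that floor
-- becomes the upper bound `t`.
⌈/⌉-least : ∀ {a t} b .{{_ : NonZero b}} → a ≤ b * t → ⌈ a / b ⌉ ≤ t
-- Exposing `b` as a successor lets `ceiling` unfold to a negated integer quotient.
⌈/⌉-least {a} {t} b@(suc _) a≤bt = ℤ.drop‿+≤+ (begin
  + ⌈ a / b ⌉                   ≡⟨ +⌈/⌉≡ceiling a b ⟩
  ℤ.- ((ℤ.- + a) ℤ./ + b)       ≡⟨ cong ℤ.-_ (div-pos-is-/ℕ (ℤ.- + a) b) ⟩
  ℤ.- ((ℤ.- + a) ℤ./ℕ b)        ≤⟨ ℤ.neg-mono-≤ (i*d≤n⇒i≤n/ℕd (ℤ.- + t) (ℤ.- + a) b -tb≤-a) ⟩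
  ℤ.- (ℤ.- + t)                 ≡⟨ ℤ.neg-involutive (+ t) ⟩
  + t                           ∎)
  where
  open ℤ.≤-Reasoning
  -tb≤-a : ℤ.- + t ℤ.* + b ℤ.≤ ℤ.- + a
  -tb≤-a = begin
    ℤ.- + t ℤ.* + b    ≡⟨ ℤ.neg-distribˡ-* (+ t) (+ b) ⟨
    ℤ.- (+ t ℤ.* + b)  ≡⟨ cong ℤ.-_ (ℤ.pos-* t b) ⟨
    ℤ.- + (t * b)      ≤⟨ ℤ.neg-mono-≤ (ℤ.+≤+ (subst (a ≤_) (*-comm b t) a≤bt)) ⟩
    ℤ.- + a            ∎

sum-mono-≤ : ∀ {n} {f g : Fin n → ℕ} → (∀ i → f i ≤ g i) → sum f ≤ sum g
sum-mono-≤ {zero}  f≤g = z≤n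
sum-mono-≤ {suc n} f≤g = +-mono-≤ (f≤g zero) (sum-mono-≤ (λ i → f≤g (suc i)))

f[i]≤sum : ∀ {n} (f : Fin n → ℕ) i → f i ≤ sum f
f[i]≤sum f zero    = m≤m+n _ _
f[i]≤sum f (suc i) = m≤n⇒m≤o+n (f zero) (f[i]≤sum (λ j → f (suc j)) i)

module _ {n} (S : Subset n) where

  sum∈-cong : ∀ {f g : Fin n → ℕ} → (∀ i → f i ≡ g i) → sum∈ S f ≡ sum∈ S g
  sum∈-cong f≗g = sum-cong-≗ λ i → cong (λ v → if lookup S i then v else 0) (f≗g i)

  sum∈-zero : ∀ {f : Fin n → ℕ} → (∀ i → i ∈ S → f i ≡ 0) → sum∈ S f ≡ 0
  sum∈-zero {f} f≡0 = trans (sum-cong-≗ term) (sum-replicate-zero n)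
    where
    term : ∀ i → (if lookup S i then f i else 0) ≡ 0
    term i with lookup S i in eq
    ... | true  = f≡0 i (lookup⇒[]= i S eq)
    ... | false = refl

  sum∈≤sum : ∀ (f : Fin n → ℕ) → sum∈ S f ≤ sum f
  sum∈≤sum f = sum-mono-≤ term
    where
    term : ∀ i → (if lookup S i then f i else 0) ≤ f i
    term i with lookup S i
    ... | true  = ≤-refl
    ... | false = z≤n

  sum∈-comm : ∀ {k} (f : Fin n → Fin k → ℕ) →
              ∑[ i ∈ S ] (∑[ b < k ] f i b) ≡ ∑[ b < k ] (∑[ i ∈ S ] f i b)
  sum∈-comm {k} f = trans (sum-cong-≗ term) (∑-comm λ i b → if lookup S i then f i b else 0)
    where
    term : ∀ i → (if lookup S i then ∑[ b < k ] f i b else 0)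
               ≡ ∑[ b < k ] (if lookup S i then f i b else 0)
    -- Membership in `S` does not depend on `b`, so the conditional can move inside the inner sum.
    term i with lookup S i
    ... | true  = refl
    ... | false = sym (sum-replicate-zero k)

module _ (I : BPPS) {k : ℕ} {x y z} (feasible : ILP-N.Feasible I k x y z) where
  open BPPS I
  open ILP-N.Feasible feasible
  open ≤-Reasoning

  w≡∑wx : ∀ i → w i ≡ ∑[ b < k ] (w i * x i b)
  w≡∑wx i = begin-equality
    w i                       ≡⟨ *-identityʳ (w i) ⟨
    w i * 1                   ≡⟨ cong (w i *_) (assignment i) ⟨
    w i * ∑[ b < k ] x i b    ≡⟨ *-distribˡ-sum (w i) (x i) ⟩
    ∑[ b < k ] (w i * x i b)  ∎

  z≤1 : ∀ b → z b ≤ 1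
  z≤1 b with z-binary b
  ... | inj₁ z≡0 = ≤-trans (≤-reflexive z≡0) z≤n
  ... | inj₂ z≡1 = ≤-reflexive z≡1

  -- The factor `y c b` covers bins with and without the setup in one linear bound, which can then
  -- be summed over all bins.
  class-load≤ : ∀ c b → ∑[ i ∈ 𝓘 c ] (w i * x i b) ≤ (d ∸ s c) * y c b
  class-load≤ c b with y-binary c b
  ... | inj₁ y≡0 = ≤-trans (≤-reflexive (sum∈-zero (𝓘 c) no-load)) z≤n
    where
    no-load : ∀ i → i ∈ 𝓘 c → w i * x i b ≡ 0
    no-load i i∈𝓘c = trans
      (cong (w i *_) (n≤0⇒n≡0 (subst (x i b ≤_) y≡0 (setup c i i∈𝓘c b))))
      (*-zeroʳ (w i))
  ... | inj₂ y≡1 = begin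
    ∑[ i ∈ 𝓘 c ] (w i * x i b)  ≤⟨ m+n≤o⇒m≤o∸n _ load+s≤d ⟩
    d ∸ s c                     ≡⟨ *-identityʳ (d ∸ s c) ⟨
    (d ∸ s c) * 1               ≡⟨ cong ((d ∸ s c) *_) y≡1 ⟨
    (d ∸ s c) * y c b           ∎
    where
    load+s≤d : ∑[ i ∈ 𝓘 c ] (w i * x i b) + s c ≤ d
    load+s≤d = begin
      ∑[ i ∈ 𝓘 c ] (w i * x i b) + s c
        ≡⟨ cong (_+_ _) (trans (cong (s c *_) y≡1) (*-identityʳ (s c))) ⟨
      ∑[ i ∈ 𝓘 c ] (w i * x i b) + s c * y c b
        -- Items and setups of the other classes only add to the load of the bin.
        ≤⟨ +-mono-≤ (sum∈≤sum (𝓘 c) _) (f[i]≤sum (λ c → s c * y c b) c) ⟩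
      ∑[ i < n ] (w i * x i b) + ∑[ c < m ] (s c * y c b)
        ≤⟨ capacity b ⟩
      d * z b
        ≤⟨ *-monoʳ-≤ d (z≤1 b) ⟩
      d * 1
        ≡⟨ *-identityʳ d ⟩
      d ∎

  -- The total weight of the class is spread over the bins, so `d ∸ s c` times the number of paid
  -- setups covers it; `γ c` is the least integer with this property.
  γ≤∑y : ∀ c → γ c ≤ ∑[ b < k ] y c b
  γ≤∑y c = ⌈/⌉-least (d ∸ s c) {{d∸s≢0 c}} (begin
    ∑[ i ∈ 𝓘 c ] w i                           ≡⟨ sum∈-cong (𝓘 c) w≡∑wx ⟩
    ∑[ i ∈ 𝓘 c ] (∑[ b < k ] (w i * x i b))    ≡⟨ sum∈-comm (𝓘 c) (λ i b → w i * x i b) ⟩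
    ∑[ b < k ] (∑[ i ∈ 𝓘 c ] (w i * x i b))    ≤⟨ sum-mono-≤ (class-load≤ c) ⟩
    ∑[ b < k ] ((d ∸ s c) * y c b)             ≡⟨ *-distribˡ-sum (d ∸ s c) (y c) ⟨
    (d ∸ s c) * ∑[ b < k ] y c b               ∎)

  γs≤∑sy : ∀ c → γ c * s c ≤ ∑[ b < k ] (s c * y c b)
  γs≤∑sy c = begin
    γ c * s c                 ≡⟨ *-comm (γ c) (s c) ⟩
    s c * γ c                 ≤⟨ *-monoʳ-≤ (s c) (γ≤∑y c) ⟩
    s c * ∑[ b < k ] y c b    ≡⟨ *-distribˡ-sum (s c) (y c) ⟩
    ∑[ b < k ] (s c * y c b)  ∎

  ∑w+∑γs≤d∑z : ∑[ i < n ] w i + ∑[ c < m ] (γ c * s c) ≤ d * ∑[ b < k ] z b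
  ∑w+∑γs≤d∑z = begin
    ∑[ i < n ] w i + ∑[ c < m ] (γ c * s c)
      -- The weights are redistributed over the bins exactly; slack enters only through setups paid
      -- beyond `γ c`.
      ≤⟨ +-mono-≤ (≤-reflexive (sum-cong-≗ w≡∑wx)) (sum-mono-≤ γs≤∑sy) ⟩
    ∑[ i < n ] (∑[ b < k ] (w i * x i b)) + ∑[ c < m ] (∑[ b < k ] (s c * y c b))
      -- Grouping by bin makes each summand the left-hand side of a capacity constraint.
      ≡⟨ cong₂ _+_ (∑-comm λ i b → w i * x i b) (∑-comm λ c b → s c * y c b) ⟩
    ∑[ b < k ] (∑[ i < n ] (w i * x i b)) + ∑[ b < k ] (∑[ c < m ] (s c * y c b))
      ≡⟨ ∑-distrib-+ (λ b → ∑[ i < n ] (w i * x i b)) (λ b → ∑[ c < m ] (s c * y c b)) ⟨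
    ∑[ b < k ] (∑[ i < n ] (w i * x i b) + ∑[ c < m ] (s c * y c b))
      ≤⟨ sum-mono-≤ capacity ⟩
    ∑[ b < k ] (d * z b)
      ≡⟨ *-distribˡ-sum d z ⟨
    d * ∑[ b < k ] z b ∎

proposition7 : (I : BPPS) → let open BPPS I in
    (k : ℕ) → 1 ≤ k → BoundsOptimalBins k →
    (x : Fin n → Fin k → ℕ) (y : Fin m → Fin k → ℕ) (z : Fin k → ℕ) →
    ILP-N.Feasible I k x y z →
    ∑[ b < k ] z b ≥ ⌈ ∑[ i < n ] w i + ∑[ c < m ] (γ c * s c) / d ⌉ {{d≢0}}
proposition7 I k _ _ x y z feasible = ⌈/⌉-least d {{d≢0}} (∑w+∑γs≤d∑z I feasible)
  where open BPPS I
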